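{- If $G$ is a tree, then ${\rm mdim}(T(G))=2n_1(G)$, where $n_1(G)$ is the number of leaves (degree-one vertices) of $G$.
   Context: For a connected graph $H$, $d_H$ is the usual distance; for a vertex $v$ and an edge $e=ww'$, $d_H(e,v)=\min\{d_H(w,v),d_H(w',v)\}$. A set $S\subseteq V(H)$ is a mixed resolving set if for every two distinct elements $x,y\in V(H)\cup E(H)$ there is $v\in S$ with $d_H(x,v)\ne d_H(y,v)$; ${\rm mdim}(H)$ is the minimum cardinality of a mixed resolving set. The total graph $T(G)$ has vertex set $V(G)\cup\{v_e: e\in E(G)\}$, and its edges are: all edges of $G$; the edges $xv_e$ for each $e\in E(G)$ and each endvertex $x$ of $e$; and the edges $v_ev_f$ for distinct edges $e,f$ of $G$ sharing an endvertex.
   Formalization: The tree with exactly two vertices is excluded: for G = K₂ the total graph is K₃, which has only three vertices, so mdim(T(G)) ≤ 3, whereas 2n₁(G) = 4. -}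

module Defs where

open import Data.Nat using (ℕ; zero; suc; _≤_; _<_; _⊓_)
open import Data.Nat.Properties using (<-irrefl; <⇒≢)
open import Data.Fin using (Fin; toℕ)
open import Data.Bool using (Bool; true; false; T; if_then_else_)
open import Data.Nat.ListAction using (sum)
open import Data.List using (List; []; _∷_; length; map; allFin; filterᵇ; _∷ʳ_)
open import Data.List.Relation.Unary.Unique.Propositional using (Unique)
open import Data.List.Relation.Unary.Linked using (Linked)
open import Data.List.Membership.Propositional using (_∈_)
open import Data.Product using (Σ; ∃; _×_; _,_; proj₁; proj₂; Σ-syntax; ∃-syntax)
open import Data.Sum using (_⊎_; inj₁; inj₂)
open import Data.Empty using (⊥)
open import Relation.Nullary using (¬_)
open import Relation.Binary.PropositionalEquality using (_≡_; _≢_; refl; sym; subst)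
open import Data.Nat using (_≡ᵇ_)

record Graph (V : Set) : Set₁ where
  field
    Adj    : V → V → Set
    Adj-sym    : ∀ {u v} → Adj u v → Adj v u
    Adj-irrefl : ∀ {v} → ¬ Adj v v
open Graph public

module _ {V : Set} (H : Graph V) where

  data Walk : V → V → ℕ → Set where
    here : ∀ {u} → Walk u u 0
    step : ∀ {u w v k} → Adj H u w → Walk w v k → Walk u v (suc k)

  Connected : Set
  Connected = ∀ u v → ∃[ k ] Walk u v k

  Dist : V → V → ℕ → Set
  Dist u v k = Walk u v k × (∀ m → Walk u v m → k ≤ m)

  -- elements of V(H) ∪ E(H); an edge is given by an (ordered) pair of
  -- adjacent vertices, two such representations being the same edge iff
  -- they have the same endpoint set (see SameElem)
  data Elem : Set where
    vert : V → Elem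
    edge : (u v : V) → Adj H u v → Elem

  SameElem : Elem → Elem → Set
  SameElem (vert x) (vert y) = x ≡ y
  SameElem (vert x) (edge _ _ _) = ⊥
  SameElem (edge _ _ _) (vert y) = ⊥
  SameElem (edge u v _) (edge u' v' _) = (u ≡ u' × v ≡ v') ⊎ (u ≡ v' × v ≡ u')

  ElemDist : Elem → V → ℕ → Set
  ElemDist (vert x) s k = Dist x s k
  ElemDist (edge w w' _) s k =
    Σ[ k₁ ∈ ℕ ] Σ[ k₂ ∈ ℕ ] (Dist w s k₁ × Dist w' s k₂ × k ≡ k₁ ⊓ k₂)

  Resolves : List V → Elem → Elem → Set
  Resolves S x y =
    Σ[ s ∈ V ] (s ∈ S × Σ[ k ∈ ℕ ] Σ[ k' ∈ ℕ ]
      (ElemDist x s k × ElemDist y s k' × k ≢ k'))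

  MixedResolving : List V → Set
  MixedResolving S = ∀ x y → ¬ SameElem x y → Resolves S x y

  MixedDim : ℕ → Set
  MixedDim m =
    (Σ[ S ∈ List V ] (Unique S × MixedResolving S × length S ≡ m)) ×
    (∀ S → Unique S → MixedResolving S → m ≤ length S)

record SimpleGraph (n : ℕ) : Set where
  field
    adj      : Fin n → Fin n → Bool
    adj-sym  : ∀ u v → adj u v ≡ adj v u
    adj-irr  : ∀ v → adj v v ≡ false
open SimpleGraph public

module _ {n : ℕ} (G : SimpleGraph n) where

  asGraph : Graph (Fin n)
  asGraph = record
    { Adj = λ u v → T (adj G u v)
    ; Adj-sym = λ {u} {v} a → subst T (adj-sym G u v) a
    ; Adj-irrefl = λ {v} a → subst T (adj-irr G v) a
    }

  HasCycle : Set
  HasCycle = Σ[ c ∈ Fin n ] Σ[ rest ∈ List (Fin n) ]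
    (2 ≤ length rest × Unique (c ∷ rest) ×
     Linked (λ u v → T (adj G u v)) ((c ∷ rest) ∷ʳ c))

  IsTree : Set
  IsTree = Connected asGraph × ¬ HasCycle

  degree : Fin n → ℕ
  degree v = sum (map (λ u → if adj G v u then 1 else 0) (allFin n))

  leaves : ℕ
  leaves = length (filterᵇ (λ v → degree v ≡ᵇ 1) (allFin n))

  -- edges of G, each represented once as (u , v) with u < v
  EdgeG : Set
  EdgeG = Σ[ u ∈ Fin n ] Σ[ v ∈ Fin n ] (toℕ u < toℕ v × T (adj G u v))

  endpoint : Fin n → EdgeG → Set
  endpoint x (u , v , _) = x ≡ u ⊎ x ≡ v

  TAdj : Fin n ⊎ EdgeG → Fin n ⊎ EdgeG → Set
  TAdj (inj₁ x) (inj₁ y) = T (adj G x y)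
  TAdj (inj₁ x) (inj₂ e) = endpoint x e
  TAdj (inj₂ e) (inj₁ x) = endpoint x e
  TAdj (inj₂ e) (inj₂ f) =
    ¬ (proj₁ e ≡ proj₁ f × proj₁ (proj₂ e) ≡ proj₁ (proj₂ f)) ×
    Σ[ x ∈ Fin n ] (endpoint x e × endpoint x f)

  private
    TAdj-sym : ∀ {a b} → TAdj a b → TAdj b a
    TAdj-sym {inj₁ x} {inj₁ y} p = subst T (adj-sym G x y) p
    TAdj-sym {inj₁ x} {inj₂ e} p = p
    TAdj-sym {inj₂ e} {inj₁ x} p = p
    TAdj-sym {inj₂ e} {inj₂ f} (ne , x , p , q) =
      (λ { (a , b) → ne (sym a , sym b) }) , x , q , p

    TAdj-irr : ∀ {a} → ¬ TAdj a a
    TAdj-irr {inj₁ x} p = subst T (adj-irr G x) p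
    TAdj-irr {inj₂ e} (ne , _) = ne (refl , refl)

  TotalGraph : Graph (Fin n ⊎ EdgeG)
  TotalGraph = record { Adj = TAdj ; Adj-sym = λ {a} {b} → TAdj-sym {a} {b} ; Adj-irrefl = λ {a} → TAdj-irr {a} }

{-# OPTIONS --safe #-}
module Submission where

-- Let S be the tree obtained from G by subdividing every edge. Then T(G) is the square of S, so
-- d_T(x, y) = ⌈d_S(x, y) / 2⌉. For a leaf ℓ with pendant edge m, the values d_T(x, ℓ) and d_T(x, m)
-- are, for x ≠ ℓ, the two roundings of d_S(x, ℓ) / 2, so together they determine it; and in a tree the distances to
-- the leaves tell apart any two distinct sets formed by one vertex or by two vertices at distance
-- at most two. Hence the leaves together with the pendant edges form a mixed resolving set.
-- Conversely, if N[a] ⊆ N[b] for adjacent a and b, only a itself resolves the edge ab and the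
-- vertex b. This applies in T(G) to (ℓ, m) and to (m, neighbour of ℓ), so all these vertices
-- are needed.

open import Defs
open import Data.Nat
  using (ℕ; zero; suc; pred; _+_; _*_; _≤_; _<_; z≤n; s≤s; s≤s⁻¹; _⊓_; ⌈_/2⌉; _≟_; _≡ᵇ_)
open import Data.Nat.Properties
open import Data.Bool using (Bool; true; false; if_then_else_; T; T?)
open import Data.Nat.ListAction using (sum)
open import Data.Bool.Properties using (T-irrelevant)
open import Data.Empty using (⊥; ⊥-elim)
open import Data.Fin using (Fin; zero; suc; toℕ)
import Data.Fin.Properties as Fin
open import Data.List using (List; []; _∷_; length; map; allFin; filterᵇ; _++_; _∷ʳ_)
open import Data.List.Properties using (length-++; length-map; length-tabulate)
open import Data.List.Membership.Propositional using (_∈_)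
open import Data.List.Membership.Propositional.Properties
open import Data.List.Relation.Binary.Subset.Propositional using (_⊆_)
open import Data.List.Relation.Unary.All using (All; []; _∷_)
import Data.List.Relation.Unary.All as All
import Data.List.Relation.Unary.All.Properties as All
open import Data.List.Relation.Unary.AllPairs using ([]; _∷_)
open import Data.List.Relation.Unary.Any using (here; there)
open import Data.List.Relation.Unary.Linked using (Linked; [-]; _∷_)
open import Data.List.Relation.Unary.Unique.Propositional using (Unique)
import Data.List.Relation.Unary.Unique.Propositional.Properties as Unique
open import Data.Product using (∃₂; _×_; _,_; proj₁; proj₂; ∃-syntax; Σ-syntax)
open import Data.Sum using (_⊎_; inj₁; inj₂; swap)
import Data.Sum as Sum
import Data.Sum.Properties as Sum
open import Function using (_∘_)
open import Relation.Binary using (DecidableEquality; tri<; tri≈; tri>)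
open import Relation.Nullary using (¬_; Dec; yes; no; contradiction)
open import Relation.Nullary.Decidable using (_⊎-dec_)
open import Relation.Binary.PropositionalEquality

-- Non-backtracking walks, and vertices that only they themselves can resolve.

module _ {V : Set} (H : Graph V) where

  -- A non-backtracking walk a, b, …, y, z with k edges.
  data Trail : V → V → V → V → ℕ → Set where
    one  : ∀ {a b} → Adj H a b → Trail a b a b 1
    cons : ∀ {a b c y z k} → Adj H a b → a ≢ c → Trail b c y z k → Trail a b y z (suc k)

module _ {V : Set} {H : Graph V} where

  snoc : ∀ {a b y z w k} → Trail H a b y z k → y ≢ w → Adj H z w → Trail H a b z w (suc k)
  snoc (one p)      ne q = cons p ne (one q)
  snoc (cons p m t) ne q = cons p m (snoc t ne q)

  append : ∀ {a b y z c u v k m} → Trail H a b y z k → y ≢ c → Trail H z c u v m →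
           Trail H a b u v (k + m)
  append (one p)      ne s = cons p ne s
  append (cons p m t) ne s = cons p m (append t ne s)

  reverse : ∀ {a b y z k} → Trail H a b y z k → Trail H z y b a k
  reverse (one p)      = one (Adj-sym H p)
  reverse (cons p m t) = snoc (reverse t) (m ∘ sym) (Adj-sym H p)

  first : ∀ {a b y z k} → Trail H a b y z k → Adj H a b
  first (one p)      = p
  first (cons p _ _) = p

  _++ʷ_ : ∀ {a b c k m} → Walk H a b k → Walk H b c m → Walk H a c (k + m)
  here     ++ʷ w = w
  step p v ++ʷ w = step p (v ++ʷ w)

  Dist-unique : ∀ {u v k k'} → Dist H u v k → Dist H u v k' → k ≡ k'
  Dist-unique (w , m) (w' , m') = ≤-antisym (m _ w') (m' _ w)

  Resolves-sym : ∀ {S x y} → Resolves H S x y → Resolves H S y x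
  Resolves-sym (s , s∈S , k , k' , p , q , ne) = s , s∈S , k' , k , q , p , ne ∘ sym

  -- Replacing the first step of a walk from a, any s ≠ a is at least as close to b as to a.
  resolves-dominated : ∀ {S a b} (ab : Adj H a b) →
    (∀ {w} → Adj H a w → w ≡ b ⊎ Adj H b w) →
    Resolves H S (edge a b ab) (vert b) → a ∈ S
  resolves-dominated ab dom (s , s∈S , _ , k' , (_ , _ , (here , _) , _ , _) , _ , _) = s∈S
  resolves-dominated ab dom
    (s , s∈S , k , k' , (suc k₁ , k₂ , (step p w , _) , d₂ , k≡) , d , ne) =
      contradiction (trans k≡ (trans (m≥n⇒m⊓n≡n k₂≤) (Dist-unique d₂ d))) ne
    where
    k₂≤ : k₂ ≤ suc k₁
    k₂≤ with dom p
    ... | inj₁ refl = m≤n⇒m≤1+n (proj₂ d₂ _ w)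
    ... | inj₂ q    = proj₂ d₂ _ (step q w)

-- Distances in a connected acyclic graph.

module AcyclicGraph {V : Set} (H : Graph V) (_≟ᵥ_ : DecidableEquality V)
  (acyclic : ∀ {a b y k} → ¬ Trail H a b y a k) (connected : Connected H) where

  -- If the first edges differ, reversing one trail and continuing with the other gives a closed
  -- trail at `z`. Otherwise the common edge is removed; should one trail end there, what remains of
  -- the other is closed.
  trail-unique : ∀ {a b b' y y' z k k'} → Trail H a b y z k → Trail H a b' y' z k' →
                 b ≡ b' × k ≡ k'
  trail-unique {b = b} {b'} t t' with b ≟ᵥ b'
  ... | no b≢b' = contradiction (append (reverse t) b≢b' t') acyclic
  trail-unique (one _)      (one _)       | yes refl = refl , refl
  trail-unique (one _)      (cons _ _ t') | yes refl = contradiction t' acyclic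
  trail-unique (cons _ _ t) (one _)       | yes refl = contradiction t acyclic
  trail-unique (cons _ _ t) (cons _ _ t') | yes refl = refl , cong suc (proj₂ (trail-unique t t'))

  -- A trail has at least one edge, so the empty path is a separate alternative.
  Path : V → V → ℕ → Set
  Path x y k = (x ≡ y × k ≡ 0) ⊎ (∃₂ λ b b' → Trail H x b b' y k)

  path-unique : ∀ {x y k k'} → Path x y k → Path x y k' → k ≡ k'
  path-unique (inj₁ (_ , refl))    (inj₁ (_ , refl))    = refl
  path-unique (inj₁ (refl , _))    (inj₂ (_ , _ , t))   = contradiction t acyclic
  path-unique (inj₂ (_ , _ , t))   (inj₁ (refl , _))    = contradiction t acyclic
  path-unique (inj₂ (_ , _ , t))   (inj₂ (_ , _ , t'))  = proj₂ (trail-unique t t')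

  tail : ∀ {a b y z k} → Trail H a b y z (suc k) → Path b z k
  tail (one _)      = inj₁ (refl , refl)
  tail (cons _ _ t) = inj₂ (_ , _ , t)

  reduce : ∀ {x y m} → Walk H x y m → ∃[ k ] (k ≤ m × Path x y k)
  reduce here = 0 , z≤n , inj₁ (refl , refl)
  reduce (step {u = x} p w) with reduce w
  ... | _ , _ , inj₁ (refl , refl) = 1 , s≤s z≤n , inj₂ (_ , _ , one p)
  ... | k , k≤m , inj₂ (c , _ , t) with x ≟ᵥ c
  ...   | no x≢c = suc k , s≤s k≤m , inj₂ (_ , _ , cons p x≢c t)
  -- The reduced walk comes straight back to `x`, so the new edge cancels against its first edge.
  reduce (step p w) | suc k , k≤m , inj₂ (c , _ , t) | yes refl =
    k , m≤n⇒m≤1+n (<⇒≤ k≤m) , tail t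
  reduce (step p w) | zero , _ , inj₂ (c , _ , ()) | yes refl

  -- `connected` supplies an arbitrary walk. By `path-unique` the length of its reduction does not
  -- depend on that choice, and by `dist≤walk` it is the graph distance.
  dist : V → V → ℕ
  dist x y = proj₁ (reduce (proj₂ (connected x y)))

  path : ∀ x y → Path x y (dist x y)
  path x y = proj₂ (proj₂ (reduce (proj₂ (connected x y))))

  path-length : ∀ {x y k} → Path x y k → dist x y ≡ k
  path-length p = path-unique (path _ _) p

  trail-length : ∀ {x b y z k} → Trail H x b y z k → dist x z ≡ k
  trail-length t = path-length (inj₂ (_ , _ , t))

  dist≤walk : ∀ {x y m} → Walk H x y m → dist x y ≤ m
  dist≤walk w with reduce w
  ... | k , k≤m , p = subst (_≤ _) (sym (path-length p)) k≤m

  dist-refl : ∀ x → dist x x ≡ 0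
  dist-refl x = path-length (inj₁ (refl , refl))

  trail : ∀ {x y} → x ≢ y → ∃₂ λ b b' → Trail H x b b' y (dist x y)
  trail {x} {y} x≢y with path x y
  ... | inj₁ (x≡y , _) = contradiction x≡y x≢y
  ... | inj₂ t         = t

  positive : ∀ {a b y z k} → Trail H a b y z k → 0 < k
  positive (one _)      = s≤s z≤n
  positive (cons _ _ _) = s≤s z≤n

  short : ∀ {a b y z k} → Trail H a b y z k → k ≤ 1 → b ≡ z × Adj H a z
  short (one p) _ = refl , p
  short (cons _ _ (one _)) (s≤s ())
  short (cons _ _ (cons _ _ _)) (s≤s ())

  second-closer : ∀ {a b y z k} → Trail H a b y z k → dist b z < k
  second-closer {k = suc k} t = s≤s (≤-reflexive (path-length (tail t)))

  -- Since `e ≢ c`, the trail from `b` to `ℓ` runs back through `a`, so `b` is `m` steps further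
  -- away than `a`.
  branches-closer : ∀ {a c ℓ b e y z k m} → Trail H a c y ℓ k → Trail H a e z b m → e ≢ c →
                    dist a ℓ < dist b ℓ
  branches-closer {k = k} {m = m} t s ne =
    subst₂ _<_ (sym (trail-length t)) (sym (trail-length (append (reverse s) ne t)))
      (m<n+m k (positive s))

  -- Separating one- and two-point sets by their distances to leaves.

  module Separation (Leaf : V → Set)
    (branch : ∀ {a c} → Adj H a c → Leaf a ⊎ ∃[ c' ] (c' ≢ c × Adj H a c'))
    (toLeaf : ∀ {a c} → Adj H a c → ∃[ ℓ ] (Leaf ℓ × ∃₂ λ y k → Trail H a c y ℓ k)) where

    -- A pair stands for the set of its entries, so that a single vertex `x` is encoded as `(x , x)`
    -- and needs no separate treatment.
    _∈₂_ : V → V × V → Set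
    x ∈₂ (a , b) = x ≡ a ⊎ x ≡ b

    _∈₂?_ : ∀ x A → Dec (x ∈₂ A)
    x ∈₂? (a , b) = (x ≟ᵥ a) ⊎-dec (x ≟ᵥ b)

    Near : V × V → Set
    Near (a , b) = dist a b ≤ 2

    dist₂ : V × V → V → ℕ
    dist₂ (a , b) s = dist a s ⊓ dist b s

    Closer : V × V → V × V → Set
    Closer A B = ∃[ ℓ ] (Leaf ℓ × dist₂ A ℓ < dist₂ B ℓ)

    swap₂ : V × V → V × V
    swap₂ (a , b) = b , a

    dist-sym : ∀ x y → dist x y ≡ dist y x
    dist-sym x y with path x y
    ... | inj₁ (refl , _)  = refl
    ... | inj₂ (_ , _ , t) = sym (trail-length (reverse t))

    Near-swap : ∀ A → Near A → Near (swap₂ A)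
    Near-swap (a , b) = subst (_≤ 2) (dist-sym a b)

    Closer-swapˡ : ∀ A B → Closer A B → Closer (swap₂ A) B
    Closer-swapˡ (a , a') B (ℓ , l , lt) = ℓ , l , subst (_< dist₂ B ℓ) (⊓-comm (dist a ℓ) _) lt

    Closer-swapʳ : ∀ A B → Closer A B → Closer A (swap₂ B)
    Closer-swapʳ A (b , b') (ℓ , l , lt) = ℓ , l , subst (dist₂ A ℓ <_) (⊓-comm (dist b ℓ) _) lt

    closerVertex : ∀ {a b b' ℓ} → dist a ℓ < dist b ℓ → dist a ℓ < dist b' ℓ → ∀ a' →
                   dist₂ (a , a') ℓ < dist₂ (b , b') ℓ
    closerVertex {a} {ℓ = ℓ} p q a' = ≤-<-trans (m⊓n≤m (dist a ℓ) (dist a' ℓ)) (⊓-pres-m< p q)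

    self-closest : ∀ {a b} → a ≢ b → dist a a < dist b a
    self-closest {a} {b} a≢b with path b a
    ... | inj₁ (b≡a , _)  = contradiction (sym b≡a) a≢b
    ... | inj₂ (_ , _ , t) = subst₂ _<_ (sym (dist-refl a)) (sym (trail-length t)) (positive t)

    -- The trail joining `b` to `b'` runs through `a`. Its two legs have total length at most two,
    -- so each is a single edge.
    between : ∀ {a b b' c c' y y' k k'} → Near (b , b') →
              Trail H a c y b k → Trail H a c' y' b' k' → c ≢ c' →
              Adj H a b × Adj H a b' × b ≢ b'
    between {k = k} {k'} near t t' c≢c'
      with k+k'≤2 ← subst (_≤ 2) (trail-length (append (reverse t) c≢c' t')) near
      with short t  (s≤s⁻¹ (<-≤-trans (m<m+n k (positive t')) k+k'≤2))
         | short t' (s≤s⁻¹ (<-≤-trans (m<n+m k' (positive t)) k+k'≤2))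
    ... | refl , p | refl , p' = p , p' , c≢c'

    -- If b and b' lie in the same branch at a, any leaf in another branch is closer to a.
    closerOrBetween : ∀ a {b b'} → Near (b , b') → a ≢ b → a ≢ b' →
      (∃[ ℓ ] (Leaf ℓ × dist a ℓ < dist b ℓ × dist a ℓ < dist b' ℓ)) ⊎
      (Adj H a b × Adj H a b' × b ≢ b')
    closerOrBetween a near a≢b a≢b' with trail a≢b | trail a≢b'
    ... | c , _ , t | c' , _ , t' with c ≟ᵥ c'
    ...   | no c≢c' = inj₂ (between near t t' c≢c')
    ...   | yes refl with branch (first t)
    ...     | inj₁ leaf = inj₁ (a , leaf , self-closest a≢b , self-closest a≢b')
    ...     | inj₂ (e , e≢c , q) with toLeaf q
    ...       | ℓ , leaf , _ , _ , s =
      inj₁ (ℓ , leaf , branches-closer s t (e≢c ∘ sym) , branches-closer s t' (e≢c ∘ sym))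

    Comparable : V × V → V × V → Set
    Comparable A B = Closer A B ⊎ Closer B A

    -- In the second case a', b, a, b' is a path, and a leaf beyond a' is closer to (a , a').
    crossing : ∀ {a a' b b'} → Near (a , a') → Adj H a b → Adj H a b' → b ≢ b' →
               b ≢ a → b ≢ a' → Comparable (a , a') (b , b')
    crossing {a} {a'} {b} {b'} near p p' b≢b' b≢a b≢a' with closerOrBetween b near b≢a b≢a'
    ... | inj₁ (ℓ , leaf , lt , lt') = inj₂ (ℓ , leaf , closerVertex lt lt' b')
    ... | inj₂ (_ , q' , a≢a') with toLeaf q'
    ...   | ℓ , leaf , _ , k , t =
      inj₁ (Closer-swapˡ (a' , a) _ (ℓ , leaf , closerVertex a'<b (<-≤-trans a'<b b≤b') a))
      where
      a'<b : dist a' ℓ < dist b ℓ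
      a'<b = subst (dist a' ℓ <_) (sym (trail-length t)) (second-closer t)
      b≤b' : dist b ℓ ≤ dist b' ℓ
      b≤b' = subst₂ _≤_ (sym (trail-length t))
        (sym (trail-length (cons (Adj-sym H p') (b≢b' ∘ sym) (cons p a≢a' t)))) (m≤n+m k 2)

    -- Either some leaf is closer to `a` than to both `b` and `b'`, or `a` is the midpoint between
    -- them. In the latter case `b` and `b'` cannot both equal `a'`, and `crossing` applies to one
    -- that differs from it.
    outside : ∀ {a a' b b'} → Near (a , a') → Near (b , b') → ¬ (a ∈₂ (b , b')) →
              Comparable (a , a') (b , b')
    outside {a} {a'} {b} {b'} nearA nearB a∉B
      with closerOrBetween a nearB (a∉B ∘ inj₁) (a∉B ∘ inj₂)
    ... | inj₁ (ℓ , leaf , lt , lt') = inj₁ (ℓ , leaf , closerVertex lt lt' a')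
    ... | inj₂ (p , p' , b≢b') with b ≟ᵥ a' | b' ≟ᵥ a'
    ...   | no b≢a'  | _ = crossing nearA p p' b≢b' (a∉B ∘ inj₁ ∘ sym) b≢a'
    ...   | yes b≡a' | yes b'≡a' = contradiction (trans b≡a' (sym b'≡a')) b≢b'
    ...   | yes _    | no b'≢a' =
      Sum.map (Closer-swapʳ _ (b' , b)) (Closer-swapˡ (b' , b) _)
        (crossing nearA p' p (b≢b' ∘ sym) (a∉B ∘ inj₂ ∘ sym) b'≢a')

    _⊆₂_ : V × V → V × V → Set
    (a , a') ⊆₂ B = a ∈₂ B × a' ∈₂ B

    ⊆₂-or-comparable : ∀ A B → Near A → Near B → A ⊆₂ B ⊎ Comparable A B
    ⊆₂-or-comparable (a , a') B nearA nearB with a ∈₂? B | a' ∈₂? B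
    ... | yes p | yes p' = inj₁ (p , p')
    ... | no p  | _      = inj₂ (outside nearA nearB p)
    ... | yes _ | no p'  = inj₂ (Sum.map (Closer-swapˡ (a' , a) _) (Closer-swapʳ _ (a' , a))
                                  (outside (Near-swap (a , a') nearA) nearB p'))

    comparable : ∀ A B → Near A → Near B → ¬ (A ⊆₂ B × B ⊆₂ A) → Comparable A B
    comparable A B nearA nearB A≠B with ⊆₂-or-comparable A B nearA nearB
    ... | inj₂ c   = c
    ... | inj₁ A⊆B with ⊆₂-or-comparable B A nearB nearA
    ...   | inj₁ B⊆A = contradiction (A⊆B , B⊆A) A≠B
    ...   | inj₂ c   = swap c

    -- Distances and resolving sets in the square of a tree.

    -- T is the square of H.
    module Square (T : Graph V)
      (T-step₁ : ∀ {x y} → Adj H x y → Adj T x y)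
      (T-step₂ : ∀ {x y z} → Adj H x y → Adj H y z → x ≢ z → Adj T x z)
      (T-dist : ∀ {x z} → Adj T x z → Σ[ j ∈ ℕ ] (j ≤ 2 × Walk H x z j))
      (m : V → V)
      (m-unique : ∀ {ℓ y} → Leaf ℓ → Adj H ℓ y → y ≡ m ℓ) where

      -- Consecutive edges are merged in pairs; the ends of a pair are distinct because a trail does
      -- not backtrack. A single edge left over at the end accounts for the rounding up.
      Trail⇒Walkᵀ : ∀ {a b y z k} → Trail H a b y z k → Walk T a z ⌈ k /2⌉
      Trail⇒Walkᵀ (one p)                = step (T-step₁ p) here
      Trail⇒Walkᵀ (cons p ne (one q))    = step (T-step₂ p q ne) here
      Trail⇒Walkᵀ (cons p ne (cons q _ t)) = step (T-step₂ p q ne) (Trail⇒Walkᵀ t)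

      Walkᵀ⇒Walk : ∀ {x y k} → Walk T x y k → Σ[ j ∈ ℕ ] (j ≤ k + k × Walk H x y j)
      Walkᵀ⇒Walk here = 0 , z≤n , here
      Walkᵀ⇒Walk (step {k = k} p w) with T-dist p | Walkᵀ⇒Walk w
      ... | i , i≤2 , v | j , j≤ , v' = i + j ,
        subst (i + j ≤_) (cong suc (sym (+-suc k k))) (+-mono-≤ i≤2 j≤) , v ++ʷ v'

      T-Dist : ∀ x s → Dist T x s ⌈ dist x s /2⌉
      T-Dist x s = walk , shortest
        where
        walk : Walk T x s ⌈ dist x s /2⌉
        walk with dist x s | path x s
        ... | _ | inj₁ (refl , refl) = here
        ... | _ | inj₂ (_ , _ , t)   = Trail⇒Walkᵀ t
        shortest : ∀ k → Walk T x s k → ⌈ dist x s /2⌉ ≤ k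
        shortest k w with Walkᵀ⇒Walk w
        ... | j , j≤2k , v =
          -- A `T`-walk with `k` steps unfolds to at most `k + k` edges of `H`, and halving this
          -- bound gives back `k`.
          subst (⌈ dist x s /2⌉ ≤_) (sym (n≡⌈n+n/2⌉ k)) (⌈n/2⌉-mono (≤-trans (dist≤walk v) j≤2k))

      ends : Elem T → V × V
      ends (vert x)     = x , x
      ends (edge u v _) = u , v

      -- Rounding up the half is monotone and therefore commutes with the minimum; a vertex is the
      -- degenerate pair, handled by `⊓-idem`.
      T-ElemDist : ∀ x s → ElemDist T x s ⌈ dist₂ (ends x) s /2⌉
      T-ElemDist (vert x) s =
        subst (λ k → Dist T x s ⌈ k /2⌉) (sym (⊓-idem (dist x s))) (T-Dist x s)
      T-ElemDist (edge u v _) s = _ , _ , T-Dist u s , T-Dist v s ,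
        mono-≤-distrib-⊓ ⌈n/2⌉-mono (dist u s) (dist v s)

      ends-near : ∀ x → Near (ends x)
      ends-near (vert x) = subst (_≤ 2) (sym (dist-refl x)) z≤n
      ends-near (edge u v p) with T-dist p
      ... | _ , j≤2 , w = ≤-trans (dist≤walk w) j≤2

      private
        distinct : ∀ {u v} → Adj T u v → u ≢ v
        distinct p refl = Adj-irrefl T p

      ends-injective : ∀ x y → ends x ⊆₂ ends y × ends y ⊆₂ ends x → SameElem T x y
      ends-injective (vert x) (vert y) ((p , _) , _) = Sum.reduce p
      ends-injective (vert x) (edge u v p) (_ , q , r) =
        distinct p (trans (Sum.reduce q) (sym (Sum.reduce r)))
      ends-injective (edge u v p) (vert x) ((q , r) , _) =
        distinct p (trans (Sum.reduce q) (sym (Sum.reduce r)))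
      ends-injective (edge u v p) (edge u' v' _) ((inj₁ q , inj₂ r) , _) = inj₁ (q , r)
      ends-injective (edge u v p) (edge u' v' _) ((inj₂ q , inj₁ r) , _) = inj₂ (q , r)
      ends-injective (edge u v p) (edge u' v' _) ((inj₁ q , inj₁ r) , _) =
        contradiction (trans q (sym r)) (distinct p)
      ends-injective (edge u v p) (edge u' v' _) ((inj₂ q , inj₂ r) , _) =
        contradiction (trans q (sym r)) (distinct p)

      -- The trail from `ℓ` to `x` has to start with the step to `m ℓ`, and dropping it shortens the
      -- distance by one. Positivity rules out the empty trail at `x = ℓ`.
      dist-m : ∀ {ℓ} → Leaf ℓ → ∀ x → 0 < dist x ℓ → dist x (m ℓ) ≡ pred (dist x ℓ)
      dist-m {ℓ} leaf x pos with path ℓ x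
      ... | inj₁ (refl , _) = contradiction (dist-refl x) (>⇒≢ pos)
      ... | inj₂ (b , _ , t) with m-unique leaf (first t)
      ...   | refl with dist ℓ x | dist-sym ℓ x
      ...     | suc k | eq = trans (dist-sym x b) (trans (path-length (tail t)) (cong pred eq))

      dist₂-m : ∀ {ℓ} → Leaf ℓ → ∀ A → 0 < dist₂ A ℓ → dist₂ A (m ℓ) ≡ pred (dist₂ A ℓ)
      dist₂-m {ℓ} leaf (a , b) pos = trans
        (cong₂ _⊓_ (dist-m leaf a (m<n⊓o⇒m<n _ _ pos)) (dist-m leaf b (m<n⊓o⇒m<o _ _ pos)))
        (sym (mono-≤-distrib-⊓ pred-mono-≤ (dist a ℓ) (dist b ℓ)))

      -- If the rounded halves agree, then `i` is odd and `j` is `i + 1`, so lowering both by one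
      -- separates them. The first alternative is what the leaf `ℓ` sees, the second what `m ℓ`
      -- sees.
      halves-differ : ∀ i j → i < j →
        ⌈ i /2⌉ ≢ ⌈ j /2⌉ ⊎ (0 < i × ⌈ pred i /2⌉ ≢ ⌈ pred j /2⌉)
      halves-differ 0 (suc j) _ = inj₁ λ ()
      halves-differ 1 (suc (suc j)) _ = inj₂ (s≤s z≤n , λ ())
      halves-differ 1 1 (s≤s ())
      halves-differ (suc (suc i)) (suc (suc j)) (s≤s (s≤s i<j)) with halves-differ i j i<j
      ... | inj₁ ne = inj₁ (ne ∘ suc-injective)
      halves-differ (suc (suc (suc i))) (suc (suc (suc j))) _ | inj₂ (_ , ne) =
        inj₂ (s≤s z≤n , ne ∘ suc-injective)

      module _ (S : List V) (leaf∈S : ∀ {ℓ} → Leaf ℓ → ℓ ∈ S) (m∈S : ∀ {ℓ} → Leaf ℓ → m ℓ ∈ S) where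

        closer-resolves : ∀ x y → Closer (ends x) (ends y) → Resolves T S x y
        closer-resolves x y (ℓ , leaf , lt) with halves-differ (dist₂ (ends x) ℓ) (dist₂ (ends y) ℓ) lt
        ... | inj₁ ne = ℓ , leaf∈S leaf , _ , _ , T-ElemDist x ℓ , T-ElemDist y ℓ , ne
        ... | inj₂ (pos , ne) = m ℓ , m∈S leaf , _ , _ , T-ElemDist x (m ℓ) , T-ElemDist y (m ℓ) ,
          subst₂ (λ i j → ⌈ i /2⌉ ≢ ⌈ j /2⌉) (sym (dist₂-m leaf (ends x) pos))
            (sym (dist₂-m leaf (ends y) (<-trans pos lt))) ne

        resolving : MixedResolving T S
        resolving x y ne
          with comparable (ends x) (ends y) (ends-near x) (ends-near y) (ne ∘ ends-injective x y)
        ... | inj₁ c = closer-resolves x y c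
        ... | inj₂ c = Resolves-sym (closer-resolves y x c)

-- Lists without repetitions.

module _ {A : Set} where

  ∈-remove : ∀ {x y : A} ps {qs} → x ≢ y → x ∈ ps ++ y ∷ qs → x ∈ ps ++ qs
  ∈-remove []       x≢y (here x≡y)  = contradiction x≡y x≢y
  ∈-remove []       x≢y (there x∈)  = x∈
  ∈-remove (p ∷ ps) x≢y (here x≡p)  = here x≡p
  ∈-remove (p ∷ ps) x≢y (there x∈)  = there (∈-remove ps x≢y x∈)

  unique-⊆⇒length≤ : ∀ {xs ys : List A} → Unique xs → xs ⊆ ys → length xs ≤ length ys
  unique-⊆⇒length≤ {[]} _ _ = z≤n
  unique-⊆⇒length≤ {x ∷ xs} (x∉xs ∷ u) xs⊆ys with ∈-∃++ (xs⊆ys (here refl))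
  ... | ps , qs , refl = subst (suc (length xs) ≤_)
    (trans (cong suc (length-++ ps)) (trans (sym (+-suc (length ps) (length qs))) (sym (length-++ ps))))
    (s≤s (unique-⊆⇒length≤ u λ y∈xs →
      ∈-remove ps (λ y≡x → All.lookup x∉xs y∈xs (sym y≡x)) (xs⊆ys (there y∈xs))))

  unique-map : ∀ {B : Set} (f : A → B) {xs} → (∀ {x y} → x ∈ xs → y ∈ xs → f x ≡ f y → x ≡ y) →
               Unique xs → Unique (map f xs)
  unique-map f inj [] = []
  unique-map f inj (x∉xs ∷ u) =
    All.map⁺ (All.tabulate λ y∈xs fx≡fy →
      All.lookup x∉xs y∈xs (inj (here refl) (there y∈xs) fx≡fy)) ∷
    unique-map f (λ x∈ y∈ → inj (there x∈) (there y∈)) u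

  -- Together with `unique-prefix` this cuts a vertex list where it returns to its start, leaving a
  -- cycle in the form that `HasCycle` asks for.
  Linked-prefix : ∀ {R : A → A → Set} xs {y zs} → Linked R (xs ++ y ∷ zs) → Linked R (xs ∷ʳ y)
  Linked-prefix []           _       = [-]
  Linked-prefix (x ∷ [])     (r ∷ _) = r ∷ [-]
  Linked-prefix (x ∷ y ∷ xs) (r ∷ l) = r ∷ Linked-prefix (y ∷ xs) l

  unique-prefix : ∀ ps {a : A} {qs} → Unique (ps ++ a ∷ qs) → Unique (a ∷ ps)
  unique-prefix []       _ = [] ∷ []
  unique-prefix (p ∷ ps) (p∉ ∷ u) with unique-prefix ps u
  ... | a∉ ∷ v = ((λ a≡p → All.lookup p∉ (∈-++⁺ʳ ps (here refl)) (sym a≡p)) ∷ a∉) ∷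
                 (All.++⁻ˡ ps p∉ ∷ v)

  length-filterᵇ : ∀ (p : A → Bool) xs →
    sum (map (λ u → if p u then 1 else 0) xs) ≡ length (filterᵇ p xs)
  length-filterᵇ p [] = refl
  length-filterᵇ p (x ∷ xs) with p x
  ... | true  = cong suc (length-filterᵇ p xs)
  ... | false = length-filterᵇ p xs

-- Trails and leaves in a tree.

module TreeGraph {n : ℕ} (G : SimpleGraph n) (isTree : IsTree G) where

  private
    H : Graph (Fin n)
    H = asGraph G

  adj⇒≢ : ∀ {u v} → Adj H u v → u ≢ v
  adj⇒≢ p refl = Adj-irrefl H p

  -- The start `a` is left out, so that a return to it is membership in this list.
  after : ∀ {a b y z k} → Trail H a b y z k → List (Fin n)
  after (one {b = b} _)       = b ∷ []
  after (cons {b = b} _ _ t)  = b ∷ after t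

  last∈after : ∀ {a b y z k} (t : Trail H a b y z k) → z ∈ after t
  last∈after (one _)      = here refl
  last∈after (cons _ _ t) = there (last∈after t)

  length-after : ∀ {a b y z k} (t : Trail H a b y z k) → length (after t) ≡ k
  length-after (one _)      = refl
  length-after (cons _ _ t) = cong suc (length-after t)

  linked : ∀ {a b y z k} (t : Trail H a b y z k) → Linked (Adj H) (a ∷ after t)
  linked (one p)      = p ∷ [-]
  linked (cons p _ t) = p ∷ linked t

  -- The next vertex is not `a` since `a ≢ b`, nor is the one after it, by non-backtracking. Any
  -- later return closes a cycle with at least three vertices.
  no-return : ∀ {a b xs} → a ≢ b → ¬ (∃[ ys ] xs ≡ a ∷ ys) → Linked (Adj H) (a ∷ b ∷ xs) →
              Unique (b ∷ xs) → ¬ (a ∈ b ∷ xs)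
  no-return {a} {b} {xs} a≢b a≢c l u a∈ with ∈-∃++ a∈
  ... | [] , qs , refl         = a≢b refl
  ... | p ∷ [] , qs , refl     = a≢c (qs , refl)
  ... | ps@(_ ∷ _ ∷ _) , qs , refl =
    proj₂ isTree (a , ps , s≤s (s≤s z≤n) , unique-prefix ps u , Linked-prefix (a ∷ ps) l)

  trail-Unique : ∀ {a b y z k} (t : Trail H a b y z k) → Unique (a ∷ after t)
  trail-Unique {a} t = All.tabulate (λ x∈ a≡x → a∉ t (subst (_∈ after t) (sym a≡x) x∈)) ∷ rest t
    where
    rest : ∀ {a b y z k} (t : Trail H a b y z k) → Unique (after t)
    rest (one _)      = [] ∷ []
    rest (cons _ _ t) = trail-Unique t
    a∉ : ∀ {a b y z k} (t : Trail H a b y z k) → ¬ (a ∈ after t)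
    a∉ (one p) (here a≡b) = adj⇒≢ p a≡b
    a∉ t@(cons p ne s) = no-return (adj⇒≢ p) (second s ne) (linked t) (rest t)
      where
      second : ∀ {a b c y z k} (s : Trail H b c y z k) → a ≢ c → ¬ (∃[ ys ] after s ≡ a ∷ ys)
      second (one _)      ne (_ , refl) = ne refl
      second (cons _ _ _) ne (_ , refl) = ne refl

  acyclicᴳ : ∀ {a b y k} → ¬ Trail H a b y a k
  acyclicᴳ t with trail-Unique t
  ... | a∉ ∷ _ = All.lookup a∉ (last∈after t) refl

  trail-bounded : ∀ {a b y z k} → Trail H a b y z k → k < n
  trail-bounded t = subst₂ _≤_ (cong suc (length-after t)) (length-tabulate {n = n} (λ i → i))
    (unique-⊆⇒length≤ (trail-Unique t) (λ _ → ∈-allFin _))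

  neighbours : Fin n → List (Fin n)
  neighbours v = filterᵇ (adj G v) (allFin n)

  degree-neighbours : ∀ v → degree G v ≡ length (neighbours v)
  degree-neighbours v = length-filterᵇ (adj G v) (allFin n)

  ∈-neighbours : ∀ {v u} → Adj H v u → u ∈ neighbours v
  ∈-neighbours {v} {u} p = ∈-filter⁺ (T? ∘ adj G v) (∈-allFin u) p

  IsLeaf : Fin n → Set
  IsLeaf v = degree G v ≡ 1

  leaf-neighbour : ∀ {v u w} → IsLeaf v → Adj H v u → Adj H v w → u ≡ w
  leaf-neighbour {v} leaf p q =
    single (trans (sym (degree-neighbours v)) leaf) (∈-neighbours p) (∈-neighbours q)
    where
    single : ∀ {A : Set} {x y : A} {xs} → length xs ≡ 1 → x ∈ xs → y ∈ xs → x ≡ y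
    single {xs = _ ∷ []} _ (here refl) (here refl) = refl

  other-neighbour : ∀ {v u} → ¬ IsLeaf v → Adj H v u → ∃[ w ] (w ≢ u × Adj H v w)
  other-neighbour {v} {u} ¬leaf p with neighbours v in eq | ∈-neighbours p
  ... | x ∷ [] | _ = contradiction (trans (degree-neighbours v) (cong length eq)) ¬leaf
  ... | x ∷ y ∷ xs | _ with Fin._≟_ x u
  ...   | no x≢u   = x , x≢u , proj₂ (∈-filter⁻ (T? ∘ adj G v) {xs = allFin n}
                       (subst (x ∈_) (sym eq) (here refl)))
  ...   | yes refl = y , y≢x , proj₂ (∈-filter⁻ (T? ∘ adj G v) {xs = allFin n}
                       (subst (y ∈_) (sym eq) (there (here refl))))
    where
    y≢x : y ≢ x
    y≢x y≡x with subst Unique eq (Unique.filter⁺ (T? ∘ adj G v) (Unique.allFin⁺ n))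
    ... | (x≢y ∷ _) ∷ _ = x≢y (sym y≡x)

  -- A trail is prolonged past any end that is not a leaf. By `trail-bounded` it always has fewer
  -- than `n` edges, so the fuel `f` cannot run out before a leaf is reached.
  extend : ∀ f {a b y z k} → n ≤ k + f → Trail H a b y z k →
           ∃[ ℓ ] (IsLeaf ℓ × ∃₂ λ y k → Trail H a b y ℓ k)
  extend zero {k = k} n≤k t = contradiction (trail-bounded t) (≤⇒≯ (subst (n ≤_) (+-identityʳ k) n≤k))
  extend (suc f) {z = z} {k} n≤ t with degree G z ≟ 1
  ... | yes leaf = z , leaf , _ , _ , t
  ... | no ¬leaf with other-neighbour ¬leaf (first (reverse t))
  ...   | w , w≢y , p = extend f (subst (n ≤_) (+-suc k f) n≤) (snoc t (w≢y ∘ sym) p)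

  leaf-beyond : ∀ {a b} → Adj H a b → ∃[ ℓ ] (IsLeaf ℓ × ∃₂ λ y k → Trail H a b y ℓ k)
  leaf-beyond p = extend n (m≤n+m n 1) (one p)

  -- Edges of the tree and their endpoints.

  E : Set
  E = EdgeG G

  distinct-endpoints : ∀ {u v} (e : E) → endpoint G u e → endpoint G v e → u ≢ v → Adj H u v
  distinct-endpoints (_ , _ , _ , p) (inj₁ refl) (inj₂ refl) _ = p
  distinct-endpoints (_ , _ , _ , p) (inj₂ refl) (inj₁ refl) _ = Adj-sym H p
  distinct-endpoints _ (inj₁ refl) (inj₁ refl) u≢v = contradiction refl u≢v
  distinct-endpoints _ (inj₂ refl) (inj₂ refl) u≢v = contradiction refl u≢v

  edgeOf : ∀ {u v} → Adj H u v → Σ[ e ∈ E ] (endpoint G u e × endpoint G v e)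
  edgeOf {u} {v} p with <-cmp (toℕ u) (toℕ v)
  ... | tri< u<v _ _ = (u , v , u<v , p) , inj₁ refl , inj₂ refl
  ... | tri≈ _ u≡v _ = contradiction (Fin.toℕ-injective u≡v) (adj⇒≢ p)
  ... | tri> _ _ v<u = (v , u , v<u , Adj-sym H p) , inj₂ refl , inj₁ refl

  otherEnd : ∀ {u} (e : E) → endpoint G u e → ∃[ v ] (endpoint G v e × Adj H u v)
  otherEnd (u , v , _ , p) (inj₁ refl) = v , inj₂ refl , p
  otherEnd (u , v , _ , p) (inj₂ refl) = u , inj₁ refl , Adj-sym H p

  endpoint-cases : ∀ {u v w} (e : E) → endpoint G u e → endpoint G v e → u ≢ v →
                   endpoint G w e → w ≡ u ⊎ w ≡ v
  endpoint-cases _ (inj₁ refl) (inj₂ refl) _ w∈e = w∈e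
  endpoint-cases _ (inj₂ refl) (inj₁ refl) _ w∈e = swap w∈e
  endpoint-cases _ (inj₁ refl) (inj₁ refl) u≢v _ = contradiction refl u≢v
  endpoint-cases _ (inj₂ refl) (inj₂ refl) u≢v _ = contradiction refl u≢v

  edge-ext : ∀ (e f : E) → proj₁ e ≡ proj₁ f → proj₁ (proj₂ e) ≡ proj₁ (proj₂ f) → e ≡ f
  edge-ext (u , v , lt , p) (_ , _ , lt' , p') refl refl =
    cong₂ (λ lt p → u , v , lt , p) (<-irrelevant lt lt') (T-irrelevant p p')

  edge-unique : ∀ {u v} (e f : E) → u ≢ v → endpoint G u e → endpoint G v e →
                endpoint G u f → endpoint G v f → e ≡ f
  edge-unique e f _ (inj₁ refl) (inj₂ refl) (inj₁ refl) (inj₂ refl) = edge-ext e f refl refl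
  edge-unique e f _ (inj₂ refl) (inj₁ refl) (inj₂ refl) (inj₁ refl) = edge-ext e f refl refl
  -- Opposite orientations are impossible, as each edge lists its smaller endpoint first.
  edge-unique (_ , _ , lt , _) (_ , _ , lt' , _) _ (inj₁ refl) (inj₂ refl) (inj₂ refl) (inj₁ refl) =
    contradiction lt' (<-asym lt)
  edge-unique (_ , _ , lt , _) (_ , _ , lt' , _) _ (inj₂ refl) (inj₁ refl) (inj₁ refl) (inj₂ refl) =
    contradiction lt' (<-asym lt)
  edge-unique _ _ ne (inj₁ refl) (inj₁ refl) _ _ = contradiction refl ne
  edge-unique _ _ ne (inj₂ refl) (inj₂ refl) _ _ = contradiction refl ne
  edge-unique _ _ ne _ _ (inj₁ refl) (inj₁ refl) = contradiction refl ne
  edge-unique _ _ ne _ _ (inj₂ refl) (inj₂ refl) = contradiction refl ne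

  _≟ᴱ_ : DecidableEquality E
  e@(u , v , _) ≟ᴱ f@(u' , v' , _) with Fin._≟_ u u' | Fin._≟_ v v'
  ... | yes p | yes q = yes (edge-ext e f p q)
  ... | no ¬p | _     = no (¬p ∘ cong proj₁)
  ... | yes _ | no ¬q = no (¬q ∘ cong (proj₁ ∘ proj₂))

  -- The subdivided tree.

  Node : Set
  Node = Fin n ⊎ E

  SubAdj : Node → Node → Set
  SubAdj (inj₁ x) (inj₂ e) = endpoint G x e
  SubAdj (inj₂ e) (inj₁ x) = endpoint G x e
  SubAdj _        _        = ⊥

  SubAdj-sym : ∀ {a b} → SubAdj a b → SubAdj b a
  SubAdj-sym {inj₁ _} {inj₂ _} p = p
  SubAdj-sym {inj₂ _} {inj₁ _} p = p

  Sub : Graph Node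
  Sub = record
    { Adj        = SubAdj
    ; Adj-sym    = λ {a} {b} → SubAdj-sym {a} {b}
    ; Adj-irrefl = λ { {inj₁ _} () ; {inj₂ _} () }
    }

  -- Forgetting the subdivision vertices keeps the trail non-backtracking: a return from `b` to `a`
  -- would force `e` and `f` to be the same edge.
  project : ∀ {a e y z k} → Trail Sub (inj₁ a) (inj₂ e) y (inj₁ z) k →
            ∃[ b ] (endpoint G b e × ∃₂ λ y' k' → Trail H a b y' z k')
  project {e = e} (cons p ne (one q)) =
    _ , q , _ , _ , one (distinct-endpoints e p q (ne ∘ cong inj₁))
  project {e = e} (cons {c = inj₁ b} p ne (cons {c = inj₂ f} q e≢f t)) with project t
  ... | c , c∈f , _ , _ , t' = b , q , _ , _ ,
    cons (distinct-endpoints e p q (ne ∘ cong inj₁))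
      (λ { refl → e≢f (cong inj₂ (edge-unique e f (ne ∘ cong inj₁) p q c∈f (first t))) }) t'

  project (cons {c = inj₁ _} _ _ (cons {c = inj₁ _} _ _ t)) = ⊥-elim (first t)

  -- The lifted trail starts at the middle of the first edge, so `Sub-leaf-beyond` can use it as it
  -- is for an edge and prepend one step for a vertex.
  lift : ∀ {a b y z k} → Trail H a b y z k → (e : E) → endpoint G a e → endpoint G b e →
         ∃₂ λ y' k' → Trail Sub (inj₂ e) (inj₁ b) y' (inj₁ z) k'
  lift (one _) e a∈e b∈e = _ , _ , one b∈e
  lift (cons {a} {b} {c} p a≢c t) e a∈e b∈e with edgeOf (first t)
  ... | f , b∈f , c∈f with lift t f b∈f c∈f
  ...   | _ , _ , t' =
    _ , _ , cons b∈e e≢f (cons b∈f (adj⇒≢ (first t) ∘ Sum.inj₁-injective) t')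
    where
    e≢f : _≢_ {A = Node} (inj₂ e) (inj₂ f)
    e≢f refl with endpoint-cases e a∈e b∈e (adj⇒≢ p) c∈f
    ... | inj₁ c≡a = a≢c (sym c≡a)
    ... | inj₂ c≡b = adj⇒≢ (first t) (sym c≡b)

  no-closed-at-vertex : ∀ {a b y k} → ¬ Trail Sub (inj₁ a) b y (inj₁ a) k
  no-closed-at-vertex t@(cons {b = inj₂ _} _ _ _) with project t
  ... | _ , _ , _ , _ , t' = acyclicᴳ t'

  -- A closed trail at an edge e = vw either can be rotated to start at v,
  -- or leaves and enters e through the same vertex v and contains a closed trail at v.
  Sub-acyclic : ∀ {a b y k} → ¬ Trail Sub a b y a k
  Sub-acyclic {inj₁ _} t = no-closed-at-vertex t
  Sub-acyclic {inj₂ e} {inj₁ v} (cons p ne t) with first (reverse t)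
  Sub-acyclic {inj₂ e} {inj₁ v} {inj₁ w} (cons p ne t) | _ with Fin._≟_ w v
  ... | no w≢v = no-closed-at-vertex (snoc t (w≢v ∘ Sum.inj₁-injective) p)
  ... | yes refl with reverse t
  ...   | one _      = ne refl
  ...   | cons _ _ s = no-closed-at-vertex s

  Sub-walk : ∀ {u v k} → Walk H u v k → ∃[ j ] Walk Sub (inj₁ u) (inj₁ v) j
  Sub-walk here = _ , here
  Sub-walk (step p w) with edgeOf p | Sub-walk w
  ... | e , u∈e , v∈e | _ , w' = _ , step {w = inj₂ e} u∈e (step v∈e w')

  Sub-connected : Connected Sub
  Sub-connected x y with anchor x | anchor y
    where
    anchor : ∀ x → ∃[ u ] ((∃[ j ] Walk Sub x (inj₁ u) j) × (∃[ j ] Walk Sub (inj₁ u) x j))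
    anchor (inj₁ u) = u , (_ , here) , (_ , here)
    anchor (inj₂ e@(u , _)) = u , (_ , step (inj₁ refl) here) , (_ , step (inj₁ refl) here)
  ... | u , (_ , x→u) , _ | v , _ , (_ , v→y) =
    _ , x→u ++ʷ (proj₂ (Sub-walk (proj₂ (proj₁ isTree u v))) ++ʷ v→y)

  -- Subdivision vertices have degree two, so the leaves of `Sub` are those of `G`.
  SubLeaf : Node → Set
  SubLeaf (inj₁ v) = IsLeaf v
  SubLeaf (inj₂ _) = ⊥

  Sub-branch : ∀ {a c} → SubAdj a c → SubLeaf a ⊎ ∃[ c' ] (c' ≢ c × SubAdj a c')
  Sub-branch {inj₁ v} {inj₂ e} v∈e with degree G v ≟ 1
  ... | yes leaf = inj₁ leaf
  ... | no ¬leaf with otherEnd e v∈e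
  ...   | u , u∈e , p with other-neighbour ¬leaf p
  ...     | w , w≢u , q with edgeOf q
  ...       | f , v∈f , w∈f = inj₂ (inj₂ f , f≢e , v∈f)
    where
    f≢e : _≢_ {A = Node} (inj₂ f) (inj₂ e)
    f≢e refl with endpoint-cases e v∈e u∈e (adj⇒≢ p) w∈f
    ... | inj₁ w≡v = adj⇒≢ q (sym w≡v)
    ... | inj₂ w≡u = w≢u w≡u
  Sub-branch {inj₂ e} {inj₁ v} v∈e with otherEnd e v∈e
  ... | u , u∈e , p = inj₂ (inj₁ u , (λ { refl → adj⇒≢ p refl }) , u∈e)

  Sub-leaf-beyond : ∀ {a c} → SubAdj a c →
                    ∃[ ℓ ] (SubLeaf ℓ × ∃₂ λ y k → Trail Sub a c y ℓ k)
  Sub-leaf-beyond {inj₂ e} {inj₁ v} v∈e with otherEnd e v∈e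
  ... | u , u∈e , p with leaf-beyond (Adj-sym H p)
  ...   | ℓ , leaf , _ , _ , t = inj₁ ℓ , leaf , lift t e u∈e v∈e
  Sub-leaf-beyond {inj₁ v} {inj₂ e} v∈e with otherEnd e v∈e
  ... | u , u∈e , p with leaf-beyond p
  ...   | ℓ , leaf , _ , _ , t with lift t e v∈e u∈e
  ...     | _ , _ , t' = inj₁ ℓ , leaf , _ , _ , cons v∈e (adj⇒≢ p ∘ Sum.inj₁-injective) t'

  -- The total graph as the square of the subdivided tree.

  T-adj : Node → Node → Set
  T-adj = Adj (TotalGraph G)

  square₁ : ∀ {x y} → SubAdj x y → T-adj x y
  square₁ {inj₁ _} {inj₂ _} p = p
  square₁ {inj₂ _} {inj₁ _} p = p

  square₂ : ∀ {x y z} → SubAdj x y → SubAdj y z → x ≢ z → T-adj x z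
  square₂ {inj₁ _} {inj₂ e} {inj₁ _} p q ne = distinct-endpoints e p q (ne ∘ cong inj₁)
  square₂ {inj₂ e} {inj₁ x} {inj₂ f} p q ne =
    (λ { (r , s) → ne (cong inj₂ (edge-ext e f r s)) }) , x , p , q

  square-dist : ∀ {x z} → T-adj x z → Σ[ j ∈ ℕ ] (j ≤ 2 × Walk Sub x z j)
  square-dist {inj₁ _} {inj₁ _} p with edgeOf p
  ... | e , x∈e , z∈e = 2 , ≤-refl , step {w = inj₂ e} x∈e (step z∈e here)
  square-dist {inj₁ _} {inj₂ _} p = 1 , s≤s z≤n , step p here
  square-dist {inj₂ _} {inj₁ _} p = 1 , s≤s z≤n , step p here
  square-dist {inj₂ _} {inj₂ _} (_ , x , p , q) = 2 , ≤-refl , step {w = inj₁ x} p (step q here)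

  -- Leaves and pendant edges in trees with at least three vertices.

  module AtLeastThree (n≥3 : 3 ≤ n) where

    neighbour : ∀ v → ∃[ u ] Adj H v u
    neighbour v with another n≥3 v
      where
      another : ∀ {n} → 3 ≤ n → (v : Fin n) → ∃[ w ] w ≢ v
      another (s≤s (s≤s _)) zero    = suc zero , λ ()
      another (s≤s (s≤s _)) (suc _) = zero , λ ()
    ... | w , w≢v with proj₁ isTree v w
    ...   | _ , here     = contradiction refl w≢v
    ...   | _ , step p _ = _ , p

    nbr : Fin n → Fin n
    nbr = proj₁ ∘ neighbour

    -- At a leaf this is the pendant edge, by `pendant-unique`; elsewhere it is some incident edge.
    pendant : Fin n → E
    pendant v = proj₁ (edgeOf (proj₂ (neighbour v)))

    ∈-pendant : ∀ v → endpoint G v (pendant v)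
    ∈-pendant v = proj₁ (proj₂ (edgeOf (proj₂ (neighbour v))))

    nbr-∈-pendant : ∀ v → endpoint G (nbr v) (pendant v)
    nbr-∈-pendant v = proj₂ (proj₂ (edgeOf (proj₂ (neighbour v))))

    pendant-unique : ∀ {v e} → IsLeaf v → endpoint G v e → e ≡ pendant v
    pendant-unique {v} {e} leaf v∈e with otherEnd e v∈e
    ... | u , u∈e , p with leaf-neighbour leaf p (proj₂ (neighbour v))
    ...   | refl = edge-unique e (pendant v) (adj⇒≢ p) v∈e u∈e (∈-pendant v) (nbr-∈-pendant v)

    -- A walk starting at one of two adjacent leaves only alternates between them, so connectedness
    -- would leave at most two vertices.
    adjacent-leaves : ∀ {u v} → Adj H u v → IsLeaf u → IsLeaf v → ⊥
    adjacent-leaves {u} {v} p lu lv =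
      <⇒≱ n≥3 (subst (_≤ 2) (length-tabulate {n = n} (λ i → i))
        (unique-⊆⇒length≤ {ys = u ∷ v ∷ []} (Unique.allFin⁺ n)
          λ {x} _ → confined (inj₁ refl) (proj₂ (proj₁ isTree u x))))
      where
      confined : ∀ {w x k} → w ≡ u ⊎ w ≡ v → Walk H w x k → x ∈ u ∷ v ∷ []
      confined (inj₁ refl) here       = here refl
      confined (inj₂ refl) here       = there (here refl)
      confined (inj₁ refl) (step q w) = confined (inj₂ (leaf-neighbour lu q p)) w
      confined (inj₂ refl) (step q w) = confined (inj₁ (leaf-neighbour lv q (Adj-sym H p))) w

    pendant-injective : ∀ {u v} → IsLeaf u → IsLeaf v → pendant u ≡ pendant v → u ≡ v
    pendant-injective {u} {v} lu lv eq with Fin._≟_ u v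
    ... | yes u≡v = u≡v
    ... | no u≢v  = ⊥-elim (adjacent-leaves
      (distinct-endpoints (pendant v) (subst (endpoint G u) eq (∈-pendant u)) (∈-pendant v) u≢v) lu lv)

    leafList : List (Fin n)
    leafList = filterᵇ (λ v → degree G v ≡ᵇ 1) (allFin n)

    ∈-leafList⁺ : ∀ {v} → IsLeaf v → v ∈ leafList
    ∈-leafList⁺ {v} leaf =
      ∈-filter⁺ (λ v → T? (degree G v ≡ᵇ 1)) (∈-allFin v) (≡⇒≡ᵇ (degree G v) 1 leaf)

    ∈-leafList⁻ : ∀ {v} → v ∈ leafList → IsLeaf v
    ∈-leafList⁻ {v} v∈ =
      ≡ᵇ⇒≡ (degree G v) 1 (proj₂ (∈-filter⁻ (λ v → T? (degree G v ≡ᵇ 1)) {xs = allFin n} v∈))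

    basis : List Node
    basis = map inj₁ leafList ++ map (inj₂ ∘ pendant) leafList

    leaf∈basis : ∀ {v} → IsLeaf v → inj₁ v ∈ basis
    leaf∈basis leaf = ∈-++⁺ˡ (∈-map⁺ inj₁ (∈-leafList⁺ leaf))

    pendant∈basis : ∀ {v} → IsLeaf v → inj₂ (pendant v) ∈ basis
    pendant∈basis leaf = ∈-++⁺ʳ (map inj₁ leafList) (∈-map⁺ (inj₂ ∘ pendant) (∈-leafList⁺ leaf))

    basis-length : length basis ≡ 2 * leaves G
    basis-length = begin
      length basis
        ≡⟨ length-++ (map inj₁ leafList) ⟩
      length (map {B = Node} inj₁ leafList) + length (map {B = Node} (inj₂ ∘ pendant) leafList)
        ≡⟨ cong₂ _+_ (length-map inj₁ leafList) (length-map (inj₂ ∘ pendant) leafList) ⟩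
      leaves G + leaves G
        ≡⟨ cong (leaves G +_) (sym (+-identityʳ _)) ⟩
      2 * leaves G ∎
      where open ≡-Reasoning

    basis-unique : Unique basis
    basis-unique = Unique.++⁺ (unique-map inj₁ (λ { _ _ refl → refl }) leafList-unique)
      (unique-map (inj₂ ∘ pendant)
        (λ u∈ v∈ → pendant-injective (∈-leafList⁻ u∈) (∈-leafList⁻ v∈) ∘ Sum.inj₂-injective)
        leafList-unique)
      disjoint
      where
      leafList-unique : Unique leafList
      leafList-unique = Unique.filter⁺ (λ v → T? (degree G v ≡ᵇ 1)) (Unique.allFin⁺ n)
      disjoint : ∀ {x} → ¬ (x ∈ map inj₁ leafList × x ∈ map (inj₂ ∘ pendant) leafList)
      disjoint (p , q) with ∈-map⁻ inj₁ p | ∈-map⁻ (inj₂ ∘ pendant) q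
      ... | _ , _ , refl | _ , _ , ()

    -- The basis is resolving and contained in every mixed resolving set.

    open AcyclicGraph Sub (Sum.≡-dec Fin._≟_ _≟ᴱ_) Sub-acyclic Sub-connected
    open Separation SubLeaf Sub-branch Sub-leaf-beyond

    support : Node → Node
    support (inj₁ v) = inj₂ (pendant v)
    support (inj₂ e) = inj₂ e

    basis-resolving : MixedResolving (TotalGraph G) basis
    basis-resolving = Square.resolving (TotalGraph G) square₁ square₂ square-dist support
      (λ { {inj₁ v} {inj₂ e} leaf v∈e → cong inj₂ (pendant-unique leaf v∈e) })
      basis
      (λ { {inj₁ v} leaf → leaf∈basis leaf })
      (λ { {inj₁ v} leaf → pendant∈basis leaf })

    -- In the total graph a leaf `v` is adjacent only to its pendant edge and to `nbr v`, and these
    -- two are adjacent to each other.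
    leaf-required : ∀ {S v} → IsLeaf v → MixedResolving (TotalGraph G) S → inj₁ v ∈ S
    leaf-required {S} {v} leaf res =
      resolves-dominated (∈-pendant v) (λ {w} → dominated {w})
        (res (edge (inj₁ v) (inj₂ (pendant v)) (∈-pendant v)) (vert (inj₂ (pendant v))) (λ ()))
      where
      dominated : ∀ {w} → T-adj (inj₁ v) w → w ≡ inj₂ (pendant v) ⊎ T-adj (inj₂ (pendant v)) w
      dominated {inj₁ u} p with leaf-neighbour leaf p (proj₂ (neighbour v))
      ... | refl = inj₂ (nbr-∈-pendant v)
      dominated {inj₂ e} v∈e = inj₁ (cong inj₂ (pendant-unique leaf v∈e))

    -- The neighbours of the pendant edge are `v`, `nbr v` and the edges at `nbr v`, since no other
    -- edge contains the leaf `v`. All but `nbr v` itself are adjacent to `nbr v`.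
    pendant-required : ∀ {S v} → IsLeaf v → MixedResolving (TotalGraph G) S → inj₂ (pendant v) ∈ S
    pendant-required {S} {v} leaf res =
      resolves-dominated (nbr-∈-pendant v) (λ {w} → dominated {w})
        (res (edge (inj₂ (pendant v)) (inj₁ (nbr v)) (nbr-∈-pendant v)) (vert (inj₁ (nbr v))) (λ ()))
      where
      p : Adj H v (nbr v)
      p = proj₂ (neighbour v)
      dominated : ∀ {w} → T-adj (inj₂ (pendant v)) w → w ≡ inj₁ (nbr v) ⊎ T-adj (inj₁ (nbr v)) w
      dominated {inj₁ u} u∈e
        with endpoint-cases (pendant v) (∈-pendant v) (nbr-∈-pendant v) (adj⇒≢ p) u∈e
      ... | inj₁ refl = inj₂ (Adj-sym H p)
      ... | inj₂ refl = inj₁ refl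
      dominated {inj₂ f} (e≢f , x , x∈e , x∈f)
        with endpoint-cases (pendant v) (∈-pendant v) (nbr-∈-pendant v) (adj⇒≢ p) x∈e
      ... | inj₂ refl = inj₂ x∈f
      ... | inj₁ refl = contradiction (cong proj₁ e≡f , cong (proj₁ ∘ proj₂) e≡f) e≢f
        where
        e≡f : pendant v ≡ f
        e≡f = sym (pendant-unique leaf x∈f)

    basis-minimal : ∀ S → MixedResolving (TotalGraph G) S → basis ⊆ S
    basis-minimal S res x∈ with ∈-++⁻ (map inj₁ leafList) x∈
    ... | inj₁ p with ∈-map⁻ inj₁ p
    ...   | v , v∈ , refl = leaf-required (∈-leafList⁻ v∈) res
    basis-minimal S res x∈ | inj₂ p with ∈-map⁻ (inj₂ ∘ pendant) p
    ...   | v , v∈ , refl = pendant-required (∈-leafList⁻ v∈) res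

    mixedDim : MixedDim (TotalGraph G) (2 * leaves G)
    mixedDim = (basis , basis-unique , basis-resolving , basis-length) ,
      λ S _ res → subst (_≤ length S) basis-length
        (unique-⊆⇒length≤ basis-unique (basis-minimal S res))

-- The conclusion, with the smallest trees handled directly.

theorem4p3 : (n : ℕ) (G : SimpleGraph n) → ¬ (n ≡ 2) → IsTree G →
    MixedDim (TotalGraph G) (2 * leaves G)
theorem4p3 0 G _ _ = ([] , [] , (λ x _ _ → empty x) , refl) , λ _ _ _ → z≤n
  where
  empty : ∀ {A : Set} → Elem (TotalGraph G) → A
  empty (vert (inj₁ ()))
  empty (vert (inj₂ (() , _)))
  empty (edge (inj₁ ()) _ _)
  empty (edge (inj₂ (() , _)) _ _)
-- The rewrite lets the degree of the only vertex compute to zero. There are then no leaves, and the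
-- total graph has a single element, so the empty set resolves it.
theorem4p3 1 G _ _ rewrite adj-irr G zero = ([] , [] , resolving , refl) , λ _ _ _ → z≤n
  where
  single : ∀ x → x ≡ vert (inj₁ zero)
  single (vert (inj₁ zero)) = refl
  single (vert (inj₂ (zero , zero , () , _)))
  single (edge (inj₁ zero) (inj₁ zero) p) = contradiction p (Adj-irrefl (asGraph G))
  single (edge (inj₁ _) (inj₂ (zero , zero , () , _)) _)
  single (edge (inj₂ (zero , zero , () , _)) _ _)
  resolving : MixedResolving (TotalGraph G) []
  resolving x y ne with single x | single y
  ... | refl | refl = contradiction refl ne
-- On two vertices the total graph is a triangle, which has too few vertices for the value
-- `2 * leaves G`, namely four.
theorem4p3 2 G n≢2 _ = contradiction refl n≢2
theorem4p3 (suc (suc (suc _))) G _ isTree =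
  TreeGraph.AtLeastThree.mixedDim G isTree (s≤s (s≤s (s≤s z≤n)))
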